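{- Let $n \geq 1$ be an integer and consider Nim on the hypercube $Q_{2n}$ in which every edge has weight $1$, with the playing piece $\Delta$ starting at the vertex $\emptyset$. Then the second player $P_2$ has a winning strategy.
   Context: Nim on a graph: two players agree on a finite simple undirected graph $G$ whose edges carry positive integer weights, and a starting vertex on which a playing piece $\Delta$ is placed. Players $P_1$ (who moves first) and $P_2$ alternate. On a turn, the player chooses an edge of positive weight incident with the vertex currently holding $\Delta$, lowers that edge's weight by a positive integer amount, and moves $\Delta$ to the other endpoint of that edge. Edges of weight $0$ are no longer playable. A player who cannot move (no playable edge is incident with $\Delta$) loses. With unit weight, each edge can be traversed at most once in total. The hypercube $Q_m$ has as vertices the subsets $X \subseteq \{1,\dots,m\}$, two vertices being adjacent iff they differ in exactly one element; $\emptyset$ denotes the empty set. -}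

module Defs where

open import Data.Bool using (Bool; if_then_else_)
open import Data.Fin using (Fin; zero)
open import Data.Fin.Properties using (2↔Bool; *↔×; inj⇒≟)
open import Data.Fin.Subset using (Subset; _∈_; _∉_)
open import Data.Nat using (ℕ; zero; suc; _^_; _<_; z≤n; s≤s)
open import Data.Product using (∃-syntax; ∃!; _×_; _,_; swap; uncurry)
open import Data.Product.Function.NonDependent.Propositional using (_×-↔_)
open import Data.Sum using (_⊎_; inj₁; inj₂) renaming (swap to ⊎-swap)
open import Data.Unit using (⊤)
open import Data.Vec using (Vec; []; _∷_)
open import Function.Bundles using (_↔_; mk↔ₛ′)
open import Function.Properties.Inverse using (↔-sym; ↔-trans; ↔⇒↣)
open import Relation.Binary.Definitions using (DecidableEquality)
open import Relation.Binary.PropositionalEquality using (_≡_; refl)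
open import Relation.Nullary using (¬_; does; _×-dec_; _⊎-dec_)

record Graph : Set₁ where
  field
    Vertex    : Set
    order     : ℕ
    enumerate : Vertex ↔ Fin order
    _~_       : Vertex → Vertex → Set
    ~-sym     : ∀ {u v} → u ~ v → v ~ u
    ~-irrefl  : ∀ {v} → ¬ (v ~ v)

  _≟_ : DecidableEquality Vertex
  _≟_ = inj⇒≟ (↔⇒↣ enumerate)

-- Only the values of `weight` at adjacent pairs are meaningful; the values at
-- other pairs are never consulted by the game.
record WeightedGraph : Set₁ where
  field
    graph : Graph
  open Graph graph public
  field
    weight          : Vertex → Vertex → ℕ
    weight-sym      : ∀ {u v} → u ~ v → weight u v ≡ weight v u
    weight-positive : ∀ {u v} → u ~ v → 0 < weight u v

unitWeights : Graph → WeightedGraph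
unitWeights G = record
  { graph           = G
  ; weight          = λ _ _ → 1
  ; weight-sym      = λ _ → refl
  ; weight-positive = λ _ → s≤s z≤n
  }

data Player : Set where
  P₁ P₂ : Player

opponent : Player → Player
opponent P₁ = P₂
opponent P₂ = P₁

module Nim (W : WeightedGraph) where
  open WeightedGraph W

  record Position : Set where
    constructor position
    field
      Δ             : Vertex
      currentWeight : Vertex → Vertex → ℕ
  open Position public

  -- A move names the other endpoint of the chosen edge and the weight that the
  -- edge has afterwards.
  record Move : Set where
    constructor move
    field
      target    : Vertex
      newWeight : ℕ
  open Move public

  -- Lowering the weight strictly forces the chosen edge to have positive weight.
  Legal : Position → Move → Set
  Legal p m = (Δ p ~ target m) × (newWeight m < currentWeight p (Δ p) (target m))

  -- The edge is undirected, so both orientations receive the new weight.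
  setWeight : (Vertex → Vertex → ℕ) → Vertex → Vertex → ℕ →
              (Vertex → Vertex → ℕ)
  setWeight w u v k x y =
    if does (((x ≟ u) ×-dec (y ≟ v)) ⊎-dec ((x ≟ v) ×-dec (y ≟ u)))
    then k else w x y

  after : Position → Move → Position
  after p m =
    position (target m) (setWeight (currentWeight p) (Δ p) (target m) (newWeight m))

  Stuck : Position → Set
  Stuck p = ¬ (∃[ m ] Legal p m)

  initial : Vertex → Position
  initial v = position v weight

  -- Finite sequences of legal moves from the starting vertex v, indexed by the
  -- position reached.
  data Play (v : Vertex) : Position → Set where
    start     : Play v (initial v)
    _then_by_ : ∀ {p} → Play v p → (m : Move) → Legal p m → Play v (after p m)

  turn : ∀ {v p} → Play v p → Player
  turn start           = P₁
  turn (h then _ by _) = opponent (turn h)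

  -- A strategy may depend on the whole history, and must produce a legal move
  -- whenever there is one.
  Strategy : Vertex → Player → Set
  Strategy v i = ∀ p (h : Play v p) → turn h ≡ i → (∃[ m ] Legal p m) ⊎ Stuck p

  -- Every move made by player i in the play is the one chosen by σ.  Moves are
  -- compared as data, not by their legality proofs.
  Follows : ∀ {v i p} → Strategy v i → Play v p → Set
  Follows σ start = ⊤
  Follows {i = i} σ (_then_by_ {p} h m _) =
    Follows σ h × ((t : turn h ≡ i) → ∃[ l ] σ p h t ≡ inj₁ (m , l))

  -- Every play that follows σ and has come to an end was lost by the opponent.
  -- Each move lowers the total weight of a finite graph, so there are no infinite
  -- plays to account for.
  Winning : ∀ {v i} → Strategy v i → Set
  Winning {v} {i} σ =
    ∀ {p} (h : Play v p) → Follows σ h → Stuck p → turn h ≡ opponent i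

  HasWinningStrategy : Vertex → Player → Set
  HasWinningStrategy v i = ∃[ σ ] Winning {v} {i} σ

DifferAt : ∀ {m} → Subset m → Subset m → Fin m → Set
DifferAt X Y i = (i ∈ X × i ∉ Y) ⊎ (i ∈ Y × i ∉ X)

subset↔Fin : ∀ m → Subset m ↔ Fin (2 ^ m)
subset↔Fin zero = mk↔ₛ′ (λ _ → zero) (λ _ → []) (λ { zero → refl }) (λ { [] → refl })
subset↔Fin (suc m) =
  ↔-trans uncons↔ (↔-trans (↔-sym 2↔Bool ×-↔ subset↔Fin m) (↔-sym *↔×))
  where
  uncons↔ : Vec Bool (suc m) ↔ (Bool × Vec Bool m)
  uncons↔ = mk↔ₛ′ (λ { (b ∷ X) → b , X }) (uncurry _∷_)
                  (λ _ → refl) (λ { (_ ∷ _) → refl })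

hypercube : ℕ → Graph
hypercube m = record
  { Vertex    = Subset m
  ; order     = 2 ^ m
  ; enumerate = subset↔Fin m
  ; _~_       = λ X Y → ∃! _≡_ (DifferAt X Y)
  ; ~-sym     = λ { (i , d , unique) → i , ⊎-swap d , λ d′ → unique (⊎-swap d′) }
  ; ~-irrefl  = λ { (_ , inj₁ (i∈X , i∉X) , _) → i∉X i∈X
                  ; (_ , inj₂ (i∈X , i∉X) , _) → i∉X i∈X }
  }

{-# OPTIONS --safe #-}

-- Every vertex of Q₂ₙ has even degree 2n.  As in Euler's theorem, the unplayed
-- edges at a vertex are therefore odd in number exactly when the vertex is one
-- of Δ and ∅ but not the other.  Before each move of P₂ the piece stands on a set
-- of odd size, hence not on ∅, so it has an odd number of playable edges, and P₂
-- wins by playing any of them.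
module Submission where

open import Defs
open import Data.Nat using (ℕ; _*_; _≥_)
open import Data.Fin.Subset using () renaming (⊥ to ∅)

open import Algebra.Bundles using (CommutativeMonoid; CommutativeRing)
open import Data.Bool using (Bool; T; true; false; not; _∧_; _∨_; _xor_; if_then_else_)
open import Data.Bool.Properties
  using (∧-comm; ∨-comm; not-involutive; not-distribˡ-xor; not-¬; xor-same; xor-identityʳ;
         xor-∧-commutativeRing)
open import Data.Fin using (Fin; zero; suc)
open import Data.Fin.Properties using (punchInᵢ≢i; suc-injective)
open import Data.Fin.Subset using (Subset)
open import Data.Nat using (zero; suc; _+_; _≤_; _<_; _<ᵇ_; z≤n; s≤s)
open import Data.Nat.Properties
  using (≤-refl; ≤-trans; ≤-pred; n≤0⇒n≡0; <ᵇ⇒<)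
open import Data.Product using (∃-syntax; _×_; _,_; map)
open import Data.Sum using (_⊎_; inj₁; inj₂) renaming (map to ⊎-map)
open import Data.Vec using ([]; _∷_; here; there; foldr′; updateAt)
open import Data.Vec.Functional using (removeAt; replicate)
open import Function using (_∘_)
open import Relation.Binary.PropositionalEquality
open import Relation.Nullary using (¬_; Dec; does; yes; no; contradiction; _×-dec_; _⊎-dec_)
open import Relation.Nullary.Decidable using (dec-true; dec-false)

-- Parities as sums in the group of order two, with `true` for odd.

xor-commutativeMonoid : CommutativeMonoid _ _
xor-commutativeMonoid = CommutativeRing.+-commutativeMonoid xor-∧-commutativeRing

open import Algebra.Properties.CommutativeMonoid.Sum xor-commutativeMonoid
  using (sum; sum-cong-≗; sum-remove; sum-replicate)
open import Algebra.Properties.CommutativeMonoid.Mult xor-commutativeMonoid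
  using (×-homo-+)

sum-true⇒∃true : ∀ {n} (f : Fin n → Bool) → sum f ≡ true → ∃[ i ] f i ≡ true
sum-true⇒∃true {suc n} f odd with f zero in eq
... | true  = zero , eq
... | false with sum-true⇒∃true (f ∘ suc) odd
...   | i , fᵢ = suc i , fᵢ

-- Pulling summand `i` to the front leaves remainders that agree termwise. This is the effect of
-- playing one edge on the degree parity at an endpoint.
sum-flip : ∀ {n} (f g : Fin n → Bool) i → g i ≡ not (f i) →
           (∀ j → j ≢ i → g j ≡ f j) → sum g ≡ not (sum f)
sum-flip {suc n} f g i flipped same = begin
  sum g                            ≡⟨ sum-remove g ⟩
  g i xor sum (removeAt g i)       ≡⟨ cong₂ _xor_ flipped (sum-cong-≗ λ j →
                                        same _ (punchInᵢ≢i i j)) ⟩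
  not (f i) xor sum (removeAt f i) ≡⟨ not-distribˡ-xor (f i) _ ⟨
  not (f i xor sum (removeAt f i)) ≡⟨ cong not (sum-remove f) ⟨
  not (sum f)                      ∎
  where
  open ≡-Reasoning

sum-true-even : ∀ n → sum (replicate (2 * n) true) ≡ false
sum-true-even n = begin
  sum (replicate (2 * n) true)          ≡⟨ sum-replicate (2 * n) ⟩
  -- `2 * n` unfolds to `n + (n + 0)`: two equal halves, which cancel under `_xor_`.
  (n + (n + 0)) · true                  ≡⟨ ×-homo-+ true n (n + 0) ⟩
  (n · true) xor ((n + 0) · true)       ≡⟨ cong ((n · true) xor_) (×-homo-+ true n 0) ⟩
  (n · true) xor ((n · true) xor false) ≡⟨ cong ((n · true) xor_) (xor-identityʳ _) ⟩
  (n · true) xor (n · true)             ≡⟨ xor-same (n · true) ⟩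
  false                                 ∎
  where
  open ≡-Reasoning
  open import Algebra.Definitions.RawMonoid (CommutativeMonoid.rawMonoid xor-commutativeMonoid)
    using () renaming (_×_ to _·_)

-- Bipartite graphs that are regular of even degree.

record EvenBipartite (G : Graph) (n : ℕ) : Set where
  open Graph G
  field
    -- Numbering the neighbours of `x` bijectively by `Fin (2 * n)` fixes the degree and turns
    -- counts of incident edges into finite sums.
    neighbour            : Vertex → Fin (2 * n) → Vertex
    neighbour-adjacent   : ∀ x i → x ~ neighbour x i
    neighbour-injective  : ∀ x {i j} → neighbour x i ≡ neighbour x j → i ≡ j
    neighbour-surjective : ∀ {x y} → x ~ y → ∃[ i ] neighbour x i ≡ y
    colour               : Vertex → Bool
    colour-alternates    : ∀ {x y} → x ~ y → colour y ≡ not (colour x)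

module _ {G : Graph} {n : ℕ} (B : EvenBipartite G n) where
  open Graph G
  open EvenBipartite B
  open Nim (unitWeights G)

  -- Edge weights in the course of a play.

  Weights : Set
  Weights = Vertex → Vertex → ℕ

  setWeight-hit : ∀ w u v k {x y} → (x ≡ u × y ≡ v) ⊎ (x ≡ v × y ≡ u) →
                  setWeight w u v k x y ≡ k
  setWeight-hit w u v k {x} {y} hit = cong (if_then k else w x y)
    (dec-true (((x ≟ u) ×-dec (y ≟ v)) ⊎-dec ((x ≟ v) ×-dec (y ≟ u))) hit)

  setWeight-miss : ∀ w u v k {x y} → ¬ ((x ≡ u × y ≡ v) ⊎ (x ≡ v × y ≡ u)) →
                   setWeight w u v k x y ≡ w x y
  setWeight-miss w u v k {x} {y} miss = cong (if_then k else w x y)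
    (dec-false (((x ≟ u) ×-dec (y ≟ v)) ⊎-dec ((x ≟ v) ×-dec (y ≟ u))) miss)

  -- Exchanging `x` and `y` swaps the two disjuncts of the test, up to the order of their conjuncts.
  setWeight-sym : ∀ w u v k {x y} → w x y ≡ w y x →
                  setWeight w u v k x y ≡ setWeight w u v k y x
  setWeight-sym w u v k {x} {y} = cong₂ (if_then k else_) (begin
    (x≟u ∧ y≟v) ∨ (x≟v ∧ y≟u) ≡⟨ ∨-comm (x≟u ∧ y≟v) _ ⟩
    (x≟v ∧ y≟u) ∨ (x≟u ∧ y≟v) ≡⟨ cong₂ _∨_ (∧-comm x≟v _) (∧-comm x≟u _) ⟩
    (y≟u ∧ x≟v) ∨ (y≟v ∧ x≟u) ∎)
    where
    open ≡-Reasoning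
    x≟u = does (x ≟ u)
    x≟v = does (x ≟ v)
    y≟u = does (y ≟ u)
    y≟v = does (y ≟ v)

  setWeight-≤ : ∀ w u v k {x y b} → k ≤ b → w x y ≤ b → setWeight w u v k x y ≤ b
  setWeight-≤ w u v k {x} {y} k≤b w≤b
    with does (((x ≟ u) ×-dec (y ≟ v)) ⊎-dec ((x ≟ v) ×-dec (y ≟ u)))
  ... | true  = k≤b
  ... | false = w≤b

  -- Weights start at 1 and never rise, so a legal move can only bring its edge down to 0.
  weight≤1 : ∀ {s p} → Play s p → ∀ x y → currentWeight p x y ≤ 1
  weight≤1 start x y = ≤-refl
  weight≤1 (_then_by_ {p} h m (_ , k<w)) x y =
    setWeight-≤ (currentWeight p) (Δ p) (target m) (newWeight m)
      (≤-trans (≤-pred (≤-trans k<w (weight≤1 h _ _))) z≤n) (weight≤1 h x y)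

  -- Legality bounds the weight read from `Δ p` to the target, while the degree at the target reads
  -- the same edge the other way round.
  currentWeight-sym : ∀ {s p} → Play s p → ∀ x y →
                      currentWeight p x y ≡ currentWeight p y x
  currentWeight-sym start x y = refl
  currentWeight-sym (_then_by_ {p} h m _) x y =
    setWeight-sym (currentWeight p) (Δ p) (target m) (newWeight m) (currentWeight-sym h x y)

  newWeight≡0 : ∀ {s p m} → Play s p → Legal p m → newWeight m ≡ 0
  newWeight≡0 h (_ , k<w) = n≤0⇒n≡0 (≤-pred (≤-trans k<w (weight≤1 h _ _)))

  -- Parity of the number of playable edges at a vertex.

  oddDegree : Weights → Vertex → Bool
  oddDegree w x = sum λ i → 0 <ᵇ w x (neighbour x i)

  oddDegree-cong : ∀ w w′ {x} → (∀ y → w′ x y ≡ w x y) → oddDegree w′ x ≡ oddDegree w x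
  oddDegree-cong w w′ {x} eq = sum-cong-≗ λ i → cong (0 <ᵇ_) (eq (neighbour x i))

  -- Surjectivity of `neighbour x` finds an index for `y`, and injectivity makes it the only one, so
  -- exactly one summand changes.
  oddDegree-flip : ∀ w w′ {x y} → x ~ y → 0 < w x y → w′ x y ≡ 0 →
                   (∀ z → z ≢ y → w′ x z ≡ w x z) → oddDegree w′ x ≡ not (oddDegree w x)
  oddDegree-flip w w′ {x} x~y open-xy closed-xy same
    with neighbour-surjective x~y
  ... | i , refl = sum-flip _ _ i
    (trans (cong (0 <ᵇ_) closed-xy) (cong not (sym (positive open-xy))))
    λ j j≢i → cong (0 <ᵇ_) (same _ (j≢i ∘ neighbour-injective x))
    where
    positive : ∀ {k} → 0 < k → (0 <ᵇ k) ≡ true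
    positive (s≤s _) = refl

  -- The Euler-trail invariant, by induction on the play. At the start the piece is on `s`, the two
  -- terms cancel, and all degrees are even. A move from `u` to `v` flips the parity at these two
  -- vertices only, and so does moving the piece on the right-hand side.
  oddDegree-Δ-start : ∀ {s p} → Play s p → ∀ x →
                      oddDegree (currentWeight p) x ≡ does (x ≟ Δ p) xor does (x ≟ s)
  oddDegree-Δ-start {s} start x = trans (sum-true-even n) (sym (xor-same (does (x ≟ s))))
  oddDegree-Δ-start {s} (_then_by_ {p} h m legal@(u~v , k<w)) x = step (x ≟ u) (x ≟ v)
    where
    open ≡-Reasoning
    u   = Δ p
    v   = target m
    k   = newWeight m
    w   = currentWeight p
    w′  = setWeight w u v k
    x≟s = does (x ≟ s)

    u≢v : u ≢ v
    u≢v u≡v = ~-irrefl (subst (u ~_) (sym u≡v) u~v)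

    k≡0 : k ≡ 0
    k≡0 = newWeight≡0 h legal

    0<w : 0 < w u v
    0<w = ≤-trans (s≤s z≤n) k<w

    flip-u : oddDegree w′ u ≡ not (oddDegree w u)
    flip-u = oddDegree-flip w w′ u~v 0<w
      (trans (setWeight-hit w u v k (inj₁ (refl , refl))) k≡0)
      λ z z≢v → setWeight-miss w u v k λ
        { (inj₁ (_ , z≡v)) → z≢v z≡v
        ; (inj₂ (u≡v , _)) → u≢v u≡v }

    flip-v : oddDegree w′ v ≡ not (oddDegree w v)
    flip-v = oddDegree-flip w w′ (~-sym u~v) (subst (0 <_) (currentWeight-sym h u v) 0<w)
      (trans (setWeight-hit w u v k (inj₂ (refl , refl))) k≡0)
      λ z z≢u → setWeight-miss w u v k λ
        { (inj₁ (v≡u , _)) → u≢v (sym v≡u)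
        ; (inj₂ (_ , z≡u)) → z≢u z≡u }

    -- Taking the decisions as arguments keeps the `does` terms in the goal intact under matching;
    -- `dec-true` and `dec-false` then evaluate them.
    step : Dec (x ≡ u) → Dec (x ≡ v) → oddDegree w′ x ≡ does (x ≟ v) xor x≟s
    step (yes refl) (yes u≡v) = contradiction u≡v u≢v
    step (yes refl) (no x≢v) = begin
      oddDegree w′ x             ≡⟨ flip-u ⟩
      not (oddDegree w x)        ≡⟨ cong not (oddDegree-Δ-start h x) ⟩
      not (does (x ≟ u) xor x≟s) ≡⟨ cong (not ∘ (_xor x≟s)) (dec-true (x ≟ u) refl) ⟩
      not (not x≟s)              ≡⟨ not-involutive _ ⟩
      x≟s                        ≡⟨ cong (_xor x≟s) (dec-false (x ≟ v) x≢v) ⟨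
      does (x ≟ v) xor x≟s       ∎
    step (no x≢u) (yes refl) = begin
      oddDegree w′ x             ≡⟨ flip-v ⟩
      not (oddDegree w x)        ≡⟨ cong not (oddDegree-Δ-start h x) ⟩
      not (does (x ≟ u) xor x≟s) ≡⟨ cong (not ∘ (_xor x≟s)) (dec-false (x ≟ u) x≢u) ⟩
      not x≟s                    ≡⟨ cong (_xor x≟s) (dec-true (x ≟ v) refl) ⟨
      does (x ≟ v) xor x≟s       ∎
    step (no x≢u) (no x≢v) = begin
      oddDegree w′ x             ≡⟨ oddDegree-cong w w′ (λ y → setWeight-miss w u v k λ
                                      { (inj₁ (x≡u , _)) → x≢u x≡u
                                      ; (inj₂ (x≡v , _)) → x≢v x≡v }) ⟩
      oddDegree w x              ≡⟨ oddDegree-Δ-start h x ⟩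
      does (x ≟ u) xor x≟s       ≡⟨ cong (_xor x≟s) (dec-false (x ≟ u) x≢u) ⟩
      x≟s                        ≡⟨ cong (_xor x≟s) (dec-false (x ≟ v) x≢v) ⟨
      does (x ≟ v) xor x≟s       ∎

  -- Turns, colours and the strategy of `P₂`.

  isP₂ : Player → Bool
  isP₂ P₁ = false
  isP₂ P₂ = true

  isP₂-opponent : ∀ i → isP₂ (opponent i) ≡ not (isP₂ i)
  isP₂-opponent P₁ = refl
  isP₂-opponent P₂ = refl

  -- Each move changes both the colour under the piece and the player to move.
  colour-Δ : ∀ {s p} (h : Play s p) → colour (Δ p) ≡ isP₂ (turn h) xor colour s
  colour-Δ start = refl
  colour-Δ {s} (_then_by_ {p} h m (u~v , _)) = begin
    colour (target m)                      ≡⟨ colour-alternates u~v ⟩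
    not (colour (Δ p))                     ≡⟨ cong not (colour-Δ h) ⟩
    not (isP₂ (turn h) xor colour s)       ≡⟨ not-distribˡ-xor (isP₂ (turn h)) _ ⟩
    not (isP₂ (turn h)) xor colour s       ≡⟨ cong (_xor colour s) (isP₂-opponent (turn h)) ⟨
    isP₂ (opponent (turn h)) xor colour s  ∎
    where
    open ≡-Reasoning

  P₂-can-move : ∀ {s p} (h : Play s p) → turn h ≡ P₂ → ∃[ m ] Legal p m
  P₂-can-move {s} {p} h P₂-turn with sum-true⇒∃true _ odd
    where
    open ≡-Reasoning
    Δ≢s : Δ p ≢ s
    -- With the piece on `s` at a turn of `P₂`, the colour of `s` would equal its own negation.
    Δ≢s refl with colour s | trans (colour-Δ h) (cong (λ i → isP₂ i xor colour s) P₂-turn)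
    ... | true  | ()
    ... | false | ()
    odd : oddDegree (currentWeight p) (Δ p) ≡ true
    odd = begin
      oddDegree (currentWeight p) (Δ p)    ≡⟨ oddDegree-Δ-start h (Δ p) ⟩
      does (Δ p ≟ Δ p) xor does (Δ p ≟ s)  ≡⟨ cong₂ _xor_ (dec-true (Δ p ≟ Δ p) refl)
                                                          (dec-false (Δ p ≟ s) Δ≢s) ⟩
      true                                 ∎
  ... | i , playable =
    -- An odd sum has a `true` summand, here at `i`: that edge still has positive weight and can be
    -- lowered to 0.
    move (neighbour (Δ p) i) 0 , neighbour-adjacent (Δ p) i , <ᵇ⇒< 0 _ (subst T (sym playable) _)

  -- A player who can always move never loses: a stuck position can arise only on the turn of `P₁`.
  P₂-wins : ∀ s → HasWinningStrategy s P₂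
  P₂-wins s = (λ p h P₂-turn → inj₁ (P₂-can-move h P₂-turn)) , winning
    where
    winning : ∀ {p} (h : Play s p) → _ → Stuck p → turn h ≡ P₁
    winning h _ stuck with turn h in eq
    ... | P₁ = refl
    ... | P₂ = contradiction (P₂-can-move h eq) stuck

-- The hypercube as an even bipartite graph.

toggle : ∀ {m} → Subset m → Fin m → Subset m
toggle X i = updateAt X i not

DifferAt-suc : ∀ {m a b} {X Y : Subset m} {i} →
               DifferAt X Y i → DifferAt (a ∷ X) (b ∷ Y) (suc i)
DifferAt-suc = ⊎-map (map there λ i∉ → λ { (there i∈) → i∉ i∈ })
                     (map there λ i∉ → λ { (there i∈) → i∉ i∈ })

DifferAt-pred : ∀ {m a b} {X Y : Subset m} {i} →
                DifferAt (a ∷ X) (b ∷ Y) (suc i) → DifferAt X Y i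
DifferAt-pred = ⊎-map (map (λ { (there i∈) → i∈ }) (_∘ there))
                      (map (λ { (there i∈) → i∈ }) (_∘ there))

¬DifferAt-refl : ∀ {m} {X : Subset m} {i} → ¬ DifferAt X X i
¬DifferAt-refl (inj₁ (i∈ , i∉)) = i∉ i∈
¬DifferAt-refl (inj₂ (i∈ , i∉)) = i∉ i∈

DifferAt-zero⇒≡not : ∀ {m a b} {X Y : Subset m} →
                     DifferAt (a ∷ X) (b ∷ Y) zero → not a ≡ b
DifferAt-zero⇒≡not {b = false} (inj₁ (here , _)) = refl
DifferAt-zero⇒≡not {b = true}  (inj₁ (here , ∉)) = contradiction here ∉
DifferAt-zero⇒≡not {a = false} (inj₂ (here , _)) = refl
DifferAt-zero⇒≡not {a = true}  (inj₂ (here , ∉)) = contradiction here ∉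

¬DifferAt-zero⇒≡ : ∀ {m a b} {X Y : Subset m} →
                   ¬ DifferAt (a ∷ X) (b ∷ Y) zero → a ≡ b
¬DifferAt-zero⇒≡ {a = false} {false} _     = refl
¬DifferAt-zero⇒≡ {a = true}  {true}  _     = refl
¬DifferAt-zero⇒≡ {a = false} {true}  agree = contradiction (inj₂ (here , λ ())) agree
¬DifferAt-zero⇒≡ {a = true}  {false} agree = contradiction (inj₁ (here , λ ())) agree

-- Extensionality of subsets; it identifies the tails once the only difference is at the head.
¬DifferAt⇒≡ : ∀ {m} (X Y : Subset m) → (∀ i → ¬ DifferAt X Y i) → X ≡ Y
¬DifferAt⇒≡ []      []      _     = refl
¬DifferAt⇒≡ (a ∷ X) (b ∷ Y) agree =
  cong₂ _∷_ (¬DifferAt-zero⇒≡ (agree zero))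
            (¬DifferAt⇒≡ X Y λ i → agree (suc i) ∘ DifferAt-suc)

toggle-differs : ∀ {m} (X : Subset m) i → DifferAt X (toggle X i) i
toggle-differs (true  ∷ X) zero    = inj₁ (here , λ ())
toggle-differs (false ∷ X) zero    = inj₂ (here , λ ())
toggle-differs (_     ∷ X) (suc i) = DifferAt-suc (toggle-differs X i)

toggle-differs-only : ∀ {m} (X : Subset m) i {j} → DifferAt X (toggle X i) j → i ≡ j
toggle-differs-only (_ ∷ X) zero    {zero}  _ = refl
toggle-differs-only (_ ∷ X) zero    {suc j} d = contradiction (DifferAt-pred d) ¬DifferAt-refl
-- Toggling at `suc i` keeps the head, so a difference at `zero` would equate a Boolean with its
-- negation.
toggle-differs-only (_ ∷ X) (suc i) {zero}  d = contradiction (sym (DifferAt-zero⇒≡not d)) (not-¬ refl)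
toggle-differs-only (_ ∷ X) (suc i) {suc j} d =
  cong suc (toggle-differs-only X i (DifferAt-pred d))

-- The index is recovered as the unique place where the toggled set differs from `X`.
toggle-injective : ∀ {m} (X : Subset m) {i j} → toggle X i ≡ toggle X j → i ≡ j
toggle-injective X {i} {j} eq =
  toggle-differs-only X i (subst (λ Y → DifferAt X Y j) (sym eq) (toggle-differs X j))

-- Uniqueness rules out a difference at any index other than `i`, and at `i` a Boolean has only one
-- other value. Hence toggling reaches every neighbour.
differ-once⇒toggle : ∀ {m} (X Y : Subset m) i → DifferAt X Y i →
                     (∀ {j} → DifferAt X Y j → i ≡ j) → toggle X i ≡ Y
differ-once⇒toggle (a ∷ X) (b ∷ Y) zero d unique =
  cong₂ _∷_ (DifferAt-zero⇒≡not d)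
            (¬DifferAt⇒≡ X Y λ i dᵢ → contradiction (unique (DifferAt-suc dᵢ)) λ ())
differ-once⇒toggle (a ∷ X) (b ∷ Y) (suc i) d unique =
  cong₂ _∷_ (¬DifferAt-zero⇒≡ λ d₀ → contradiction (unique d₀) λ ())
            (differ-once⇒toggle X Y i (DifferAt-pred d)
              (suc-injective ∘ unique ∘ DifferAt-suc))

-- Cardinality modulo 2, the standard bipartition of the hypercube.
parity : ∀ {m} → Subset m → Bool
parity = foldr′ _xor_ false

parity-toggle : ∀ {m} (X : Subset m) i → parity (toggle X i) ≡ not (parity X)
parity-toggle (true  ∷ X) zero    = sym (not-involutive _)
parity-toggle (false ∷ X) zero    = refl
parity-toggle (true  ∷ X) (suc i) = cong not (parity-toggle X i)
parity-toggle (false ∷ X) (suc i) = parity-toggle X i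

hypercube-evenBipartite : ∀ n → EvenBipartite (hypercube (2 * n)) n
hypercube-evenBipartite n = record
  { neighbour            = toggle
  ; neighbour-adjacent   = λ X i → i , toggle-differs X i , toggle-differs-only X i
  ; neighbour-injective  = toggle-injective
  ; neighbour-surjective = λ { {X} {Y} (i , d , unique) →
      i , differ-once⇒toggle X Y i d unique }
  ; colour               = parity
  ; colour-alternates    = λ { {X} {Y} (i , d , unique) →
      trans (cong parity (sym (differ-once⇒toggle X Y i d unique))) (parity-toggle X i) }
  }

mainTheorem3 : (n : ℕ) → n ≥ 1 →
    Nim.HasWinningStrategy (unitWeights (hypercube (2 * n))) ∅ P₂
mainTheorem3 n _ = P₂-wins (hypercube-evenBipartite n) ∅
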